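{- There exist sets $A,B\subseteq\Sigma^*$ such that $B\leq^p_{s\text{ - }ld\text{ - }T}A$ and $B\not\leq^p_{lnd\text{ - }T}A$.
   Context: $\Sigma=\{0,1\}$; $|x|$ is the length of $x$. A DPTM is a deterministic oracle Turing machine $M$ for which there is one polynomial $p$ such that, for every oracle $X\subseteq\Sigma^*$ and input $x$, $M^X(x)$ halts within $p(|x|)$ steps; $L(M^X)$ is the set of inputs accepted with oracle $X$. $B\leq^p_{s\text{ - }ld\text{ - }T}A$ (respectively $B\leq^p_{lnd\text{ - }T}A$): there is a DPTM $M$ with $L(M^A)=B$ such that for every input $x$, either $M^A(x)$ makes no oracle queries, or the sequence $q_1,\dots,q_k$ ($k\ge1$), in order, of its queries satisfies $|x|>|q_1|>|q_2|>\dots>|q_k|$ (respectively $|q_1|\le|q_2|\le\dots\le|q_k|$). -}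

module Defs where

open import Data.Bool using (Bool; true; false; if_then_else_)
open import Data.Fin using (Fin)
open import Data.List using (List; []; _∷_; foldr; length; map)
open import Data.List.Relation.Unary.Linked using (Linked)
open import Data.Nat using (ℕ; zero; suc; _+_; _*_; _≤_; _>_)
open import Data.Product using (Σ-syntax; ∃-syntax; _×_; _,_)
open import Function.Bundles using (_⇔_)
open import Data.Vec as Vec using (Vec; _∷_)
open import Relation.Binary.PropositionalEquality using (_≡_)

Word : Set
Word = List Bool

-- A subset of Σ* is represented by its characteristic function.
Language : Set
Language = Word → Bool

-- Coefficients are listed from the constant term upwards.  Natural-number
-- coefficients lose no generality, since polynomials only serve as upper bounds.
Polynomial : Set
Polynomial = List ℕ

eval : Polynomial → ℕ → ℕ
eval p n = foldr (λ c r → c + n * r) 0 p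

-- The tape alphabet: a blank, the two letters of Σ and g auxiliary symbols.
data Symbol (g : ℕ) : Set where
  blank : Symbol g
  bit   : Bool → Symbol g
  aux   : Fin g → Symbol g

data Move : Set where
  left stay right : Move

-- A two-way infinite tape.  Both lists start next to the head, and all cells
-- beyond their ends are blank.
record Tape (g : ℕ) : Set where
  constructor tape
  field
    before : List (Symbol g)
    head   : Symbol g
    after  : List (Symbol g)

open Tape public

blankTape : ∀ {g} → Tape g
blankTape = tape [] blank []

inputTape : ∀ {g} → Word → Tape g
inputTape []      = blankTape
inputTape (b ∷ x) = tape [] (bit b) (map bit x)

write : ∀ {g} → Symbol g → Tape g → Tape g
write a (tape l _ r) = tape l a r

move : ∀ {g} → Move → Tape g → Tape g
move left  (tape []      h r) = tape [] blank (h ∷ r)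
move left  (tape (a ∷ l) h r) = tape l a (h ∷ r)
move stay  t                  = t
move right (tape l h [])      = tape (h ∷ l) blank []
move right (tape l h (a ∷ r)) = tape (h ∷ l) a r

leadingBits : ∀ {g} → List (Symbol g) → Word
leadingBits (bit b ∷ as) = b ∷ leadingBits as
leadingBits _            = []

-- The word on the query tape: it begins under the head and extends to the right
-- up to the first cell that does not hold a letter of Σ.
queryWord : ∀ {g} → Tape g → Word
queryWord t = leadingBits (head t ∷ after t)

data State (s : ℕ) : Set where
  control : Fin s → State s
  query   : State s
  halt    : Bool → State s       -- halt true accepts, halt false rejects

-- Tape 0 initially holds the input, tape 1 is the query tape, and there are
-- k further work tapes; every tape can be read and written.
record OracleTM : Set where
  field
    g s k  : ℕ
    start  : Fin s
    yes no : Fin s               -- entered after the oracle has answered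
    δ      : Fin s → Vec (Symbol g) (2 + k) →
             State s × Vec (Symbol g × Move) (2 + k)

module _ (M : OracleTM) where
  open OracleTM M

  record Config : Set where
    constructor config
    field
      state : State s
      tapes : Vec (Tape g) (2 + k)

  open Config public

  initial : Word → Config
  initial x = config (control start) (inputTape x ∷ Vec.replicate (1 + k) blankTape)

  act : Symbol g × Move → Tape g → Tape g
  act (a , m) t = move m (write a t)

  queryOf : Config → Word
  queryOf c = queryWord (Vec.head (Vec.tail (tapes c)))

  -- An oracle call takes one step and leaves all tapes unchanged.
  step : Language → Config → Config
  step X (config (control q) ts) with δ q (Vec.map head ts)
  ... | q′ , as = config q′ (Vec.zipWith act as ts)
  step X c@(config query ts) =
    config (control (if X (queryOf c) then yes else no)) ts
  step X c@(config (halt _) _) = c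

  run : Language → ℕ → Config → Config
  run X zero    c = c
  run X (suc t) c = run X t (step X c)

  askedAt : Config → List Word → List Word
  askedAt c@(config query _) qs = queryOf c ∷ qs
  askedAt _                  qs = qs

  -- The oracle queries made during the first t steps from c, in order.
  queriesFrom : Language → ℕ → Config → List Word
  queriesFrom X zero    c = []
  queriesFrom X (suc t) c = askedAt c (queriesFrom X t (step X c))

  HaltsWithin : Language → Word → ℕ → Set
  HaltsWithin X x t = ∃[ b ] state (run X t (initial x)) ≡ halt b

  Accepts : Language → Word → Set
  Accepts X x = ∃[ t ] state (run X t (initial x)) ≡ halt true

record DPTM : Set where
  field
    machine : OracleTM
    bound   : Polynomial
    halts   : ∀ (X : Language) (x : Word) →
              HaltsWithin machine X x (eval bound (length x))

  -- The machine has halted by the time bound, so these are all of its queries.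
  queries : Language → Word → List Word
  queries X x = queriesFrom machine X (eval bound (length x)) (initial machine x)

open DPTM public using (machine; queries)

infix 4 _≐L[_^_] _≤ᵖ-sld-T_ _≤ᵖ-lnd-T_

-- B = L(M^X)
_≐L[_^_] : Language → DPTM → Language → Set
B ≐L[ M ^ X ] = ∀ x → (B x ≡ true) ⇔ Accepts (machine M) X x

-- In both reducibilities the length condition holds vacuously when there are
-- no queries, since Linked R is trivial on lists with at most one element.

_≤ᵖ-sld-T_ : Language → Language → Set
B ≤ᵖ-sld-T A = Σ[ M ∈ DPTM ] (B ≐L[ M ^ A ] ×
  (∀ x → Linked _>_ (length x ∷ map length (queries M A x))))

_≤ᵖ-lnd-T_ : Language → Language → Set
B ≤ᵖ-lnd-T A = Σ[ M ∈ DPTM ] (B ≐L[ M ^ A ] ×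
  (∀ x → Linked _≤_ (map length (queries M A x))))

{-# OPTIONS --safe #-}
module Submission where

-- On inputs of length n = 2j + 2 the machine M₀ learns j bits b₁ … b_j from the
-- queries 0^(n-1), …, 0^(j+2) and then asks the single word u = 0b₁…b_j, which is
-- shorter than all of them.  A machine with nondecreasing queries must decide
-- about u before it has seen any of the bits: run it with an oracle in which they
-- are not yet set, and choose them such that u is not among its fewer than 2^j
-- queries.  Then it never asks u, and membership of u in A can be set against its
-- verdict.  A is built in stages, one for every pair of a machine and a number
-- K controlling its time bound; every stage changes only words longer than those
-- that matter for the earlier stages.

open import Data.Bool as Bool using (Bool; true; false; not; if_then_else_)
open import Data.Bool.Properties using (not-¬)
open import Data.Fin using (Fin; zero; suc; toℕ)
open import Data.List
  using (List; []; _∷_; _++_; length; map; replicate; reverse; _ʳ++_; drop; applyUpTo)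
open import Data.List.Membership.Propositional using (_∈_; _∉_)
open import Data.List.Membership.Propositional.Properties using (∈-map⁺)
open import Data.List.Properties
open import Data.List.Relation.Unary.All as All using ()
open import Data.List.Relation.Unary.Any using (here; there)
open import Data.List.Relation.Unary.Linked as Linked using (Linked; [-]; _∷_)
open import Data.List.Relation.Unary.Linked.Properties using (Linked⇒All)
open import Data.Nat
open import Data.Nat.ListAction using (sum)
open import Data.Nat.Properties
open import Data.Nat.Tactic.RingSolver using (solve-∀)
open import Data.Product using (Σ-syntax; ∃-syntax; _×_; _,_; proj₁; proj₂)
open import Data.Sum using (_⊎_; inj₁; inj₂)
open import Data.Vec as Vec using (Vec; []; _∷_)
open import Function.Base using (_∘_)
open import Function.Bundles using (_⇔_; mk⇔; Equivalence)
open import Function.Definitions using (StrictlySurjective)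
open import Relation.Binary.PropositionalEquality
open import Relation.Nullary using (¬_; yes; no; does; contradiction)
open import Relation.Nullary.Decidable using (dec-true; dec-false)
open import Defs

-- Runs

halt-injective : ∀ {s a b} → halt {s} a ≡ halt b → a ≡ b
halt-injective refl = refl

accepting : ∀ {s} → State s → Bool
accepting (halt b) = b
accepting _        = false

accepting-halt : ∀ {s b} {q : State s} → q ≡ halt b → accepting q ≡ b
accepting-halt refl = refl

module _ (M : OracleTM) where

  run-halted : ∀ X t {c : Config M} {b} → state c ≡ halt b → run M X t c ≡ c
  run-halted X zero    _    = refl
  run-halted X (suc t) refl = run-halted X t refl

  queries-halted : ∀ X t {c : Config M} {b} → state c ≡ halt b → queriesFrom M X t c ≡ []
  queries-halted X zero    _    = refl
  queries-halted X (suc t) refl = queries-halted X t refl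

  run-extend : ∀ X {t t′ c b} → t ≤ t′ → state (run M X t c) ≡ halt b →
               run M X t′ c ≡ run M X t c
  run-extend X {t′ = t′} z≤n        h = run-halted X t′ h
  run-extend X           (s≤s t≤t′) h = run-extend X t≤t′ h

  queries-extend : ∀ X {t t′ c b} → t ≤ t′ → state (run M X t c) ≡ halt b →
                   queriesFrom M X t′ c ≡ queriesFrom M X t c
  queries-extend X {t′ = t′} z≤n         h = queries-halted X t′ h
  queries-extend X {c = c}   (s≤s t≤t′) h = cong (askedAt M c) (queries-extend X t≤t′ h)

  state-extend : ∀ X {t t′ c b} → t ≤ t′ → state (run M X t c) ≡ halt b →
                 state (run M X t′ c) ≡ halt b
  state-extend X t≤t′ h = trans (cong state (run-extend X t≤t′ h)) h

  verdict-unique : ∀ X t u {c a b} → state (run M X t c) ≡ halt a →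
                   state (run M X u c) ≡ halt b → a ≡ b
  verdict-unique X t u h h′ with ≤-total t u
  ... | inj₁ t≤u = halt-injective (trans (sym (state-extend X t≤u h)) h′)
  ... | inj₂ u≤t = halt-injective (trans (sym h) (state-extend X u≤t h′))

  accepts⇔ : ∀ X x t {b} → state (run M X t (initial M x)) ≡ halt b →
             (b ≡ true) ⇔ Accepts M X x
  accepts⇔ X x t h = mk⇔ (λ { refl → t , h }) (λ { (u , h′) → verdict-unique X t u h h′ })

  verdict-decides : ∀ {B : Language} X → (∀ x → (B x ≡ true) ⇔ Accepts M X x) → ∀ x t {b} →
                    state (run M X t (initial M x)) ≡ halt b → b ≡ B x
  verdict-decides {B} X B⇔ x t {b} h with b | B x | accepts⇔ X x t h | B⇔ x
  ... | true  | true  | _ | _ = refl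
  ... | false | false | _ | _ = refl
  ... | true  | false | e | f = sym (Equivalence.from f (Equivalence.to e refl))
  ... | false | true  | e | f = Equivalence.from e (Equivalence.to f refl)

  length-queries : ∀ X t c → length (queriesFrom M X t c) ≤ t
  length-queries X zero    c                        = z≤n
  length-queries X (suc t) c@(config (control _) _) = m≤n⇒m≤1+n (length-queries X t (step M X c))
  length-queries X (suc t) c@(config query _)       = s≤s (length-queries X t (step M X c))
  length-queries X (suc t) c@(config (halt _) _)    = m≤n⇒m≤1+n (length-queries X t c)

  step-cong : ∀ {X Y} ts → X (queryOf M (config query ts)) ≡ Y (queryOf M (config query ts)) →
              step M X (config query ts) ≡ step M Y (config query ts)
  step-cong ts =
    cong (λ b → config (control (if b then OracleTM.yes M else OracleTM.no M)) ts)

  -- By induction both runs stay in the same configuration, so every query of the run with `Y` is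
  -- also one of the run with `X`.
  run-agree : ∀ {X Y} t c → (∀ q → q ∈ queriesFrom M X t c → X q ≡ Y q) →
              run M X t c ≡ run M Y t c × queriesFrom M X t c ≡ queriesFrom M Y t c
  run-agree zero c eq = refl , refl
  run-agree {X} {Y} (suc t) c@(config (control _) _) eq = run-agree {X} {Y} t (step M X c) eq
  run-agree {X} {Y} (suc t) c@(config query ts) eq
    rewrite sym (step-cong {X} {Y} ts (eq _ (here refl)))
    with r , q ← run-agree {X} {Y} t (step M X c) (λ q → eq q ∘ there)
    = r , cong (queryOf M c ∷_) q
  run-agree (suc t) c@(config (halt _) _) eq = run-agree t c eq

  -- Up to its first query longer than u the run cannot tell Y from X, and
  -- afterwards the queries are too long to be u.
  nondecreasing-avoids : ∀ {X Y} u → (∀ w → length w ≤ length u → w ≢ u → X w ≡ Y w) →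
    ∀ t c → Linked _≤_ (map length (queriesFrom M Y t c)) →
    u ∉ queriesFrom M X t c → u ∉ queriesFrom M Y t c
  nondecreasing-avoids u eq zero c lnd u∉ = u∉
  nondecreasing-avoids {X} {Y} u eq (suc t) c@(config (control _) _) lnd u∉ =
    nondecreasing-avoids {X} {Y} u eq t (step M X c) lnd u∉
  nondecreasing-avoids {X} {Y} u eq (suc t) c@(config query ts) lnd u∉ (here u≡) = u∉ (here u≡)
  nondecreasing-avoids {X} {Y} u eq (suc t) c@(config query ts) lnd u∉ (there u∈)
    with length (queryOf M c) ≤? length u
  ... | yes short = nondecreasing-avoids {X} {Y} u eq t (step M Y c) (Linked.tail lnd)
    (subst (λ d → u ∉ queriesFrom M X t d)
      (step-cong {X} {Y} ts (eq _ short (λ q≡u → u∉ (here (sym q≡u))))) (u∉ ∘ there)) u∈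
  ... | no  long  = long (All.lookup (Linked⇒All ≤-trans ≤-refl lnd) (there (∈-map⁺ length u∈)))
  nondecreasing-avoids {X} {Y} u eq (suc t) c@(config (halt _) _) lnd u∉ =
    nondecreasing-avoids {X} {Y} u eq t c lnd u∉

-- The length-decreasing machine

-- While the input head scans x from left to right, 0^|x| is written from right
-- to left on the query tape (copy).  Then the query head walks right and the
-- input head two cells left per query (walk₁, walk₂, yesₐ, noₐ); each answer
-- replaces the first letter of its query, and noₐ, entered from copy, puts a 0
-- in front.  Once the input head is on the blank left of x, the word of answers
-- is cut off from the zeros and queried from its beginning (rewind), and that
-- blank makes yesₐ and noₐ halt.  If |x| is odd the last answer is erased too:
-- otherwise the final query would be as long as the one before it.
pattern copy   = zero
pattern yesₐ   = suc zero
pattern noₐ    = suc (suc zero)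
pattern walk₁  = suc (suc (suc zero))
pattern walk₂  = suc (suc (suc (suc zero)))
pattern rewind = suc (suc (suc (suc (suc zero))))

δ₀ : Fin 6 → Vec (Symbol 0) 2 → State 6 × Vec (Symbol 0 × Move) 2
δ₀ copy   (bit a ∷ _     ∷ []) = control copy   , (bit a , right) ∷ (bit false , left) ∷ []
δ₀ copy   (_     ∷ q     ∷ []) = control noₐ    , (blank , left)  ∷ (q , right)        ∷ []
δ₀ yesₐ   (bit a ∷ _     ∷ []) = control walk₁  , (bit a , left)  ∷ (bit true , stay)  ∷ []
δ₀ yesₐ   (_     ∷ q     ∷ []) = halt true      , (blank , stay)  ∷ (q , stay)         ∷ []
δ₀ noₐ    (bit a ∷ _     ∷ []) = control walk₁  , (bit a , left)  ∷ (bit false , stay) ∷ []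
δ₀ noₐ    (_     ∷ q     ∷ []) = halt false     , (blank , stay)  ∷ (q , stay)         ∷ []
δ₀ walk₁  (bit a ∷ q     ∷ []) = control walk₂  , (bit a , left)  ∷ (q , right)        ∷ []
δ₀ walk₁  (_     ∷ _     ∷ []) = control rewind , (blank , stay)  ∷ (blank , left)     ∷ []
δ₀ walk₂  (bit a ∷ q     ∷ []) = query          , (bit a , stay)  ∷ (q , stay)         ∷ []
δ₀ walk₂  (_     ∷ _     ∷ []) = control rewind , (blank , stay)  ∷ (blank , left)     ∷ []
δ₀ rewind (i     ∷ bit a ∷ []) = control rewind , (i , stay)      ∷ (bit a , left)     ∷ []
δ₀ rewind (i     ∷ q     ∷ []) = query          , (i , stay)      ∷ (q , right)        ∷ []

M₀ : OracleTM
M₀ = record { g = 0 ; s = 6 ; k = 0 ; start = copy ; yes = yesₐ ; no = noₐ ; δ = δ₀ }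

zeros : ℕ → Word
zeros n = replicate n false

-- The tape left behind by moving left from the right of the cells l.
leftOf : List (Symbol 0) → List (Symbol 0) → Tape 0
leftOf []      r = tape [] blank r
leftOf (a ∷ l) r = tape l a r

move-left : ∀ l h r → move left (tape l h r) ≡ leftOf l (h ∷ r)
move-left []      h r = refl
move-left (_ ∷ _) h r = refl

-- r is the number of input letters that the input head has yet to pass, z the
-- number of zeros right of the query head, w the letter under it and ws the
-- letters before it, latest first.
finalWord : Language → ℕ → ℕ → Bool → Word → Word
finalWord X 0             z w ws = reverse ws
finalWord X 1             z w ws = reverse (w ∷ ws)
finalWord X (suc (suc r)) z w ws = finalWord X r (pred z) (X (zeros z)) (w ∷ ws)

walkQueries : Language → ℕ → ℕ → Bool → Word → List Word
walkQueries X 0             z w ws = reverse ws ∷ []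
walkQueries X 1             z w ws = reverse (w ∷ ws) ∷ []
walkQueries X (suc (suc r)) z w ws = zeros z ∷ walkQueries X r (pred z) (X (zeros z)) (w ∷ ws)

record Outcome (X : Language) (t : ℕ) (c : Config M₀) (b : Bool) (qs : List Word) : Set where
  constructor outcome
  field
    verdict : state (run M₀ X t c) ≡ halt b
    asked   : queriesFrom M₀ X t c ≡ qs

leadingBits-word : ∀ {g} w (as : List (Symbol g)) → leadingBits (map bit w ++ blank ∷ as) ≡ w
leadingBits-word []      as = refl
leadingBits-word (b ∷ w) as = cong (b ∷_) (leadingBits-word w as)

leadingBits-all : ∀ {g} w → leadingBits {g} (map bit w) ≡ w
leadingBits-all []      = refl
leadingBits-all (b ∷ w) = cong (b ∷_) (leadingBits-all w)

move-right : ∀ {g} w (l : List (Symbol g)) h r →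
             queryWord (move right (tape l h (map bit w ++ blank ∷ r))) ≡ w
move-right []      l h r = refl
move-right (a ∷ w) l h r = cong (a ∷_) (leadingBits-word w r)

-- Chained once per machine step. With concrete symbols under the heads the step equation is `refl`;
-- a lemma is supplied where a move must first know whether a cell remains.
before-step : ∀ {X t c d b qs} → step M₀ X c ≡ d → Outcome X t d b qs →
              Outcome X (suc t) c b (askedAt M₀ c qs)
before-step {c = c} refl (outcome v a) = outcome v (cong (askedAt M₀ c) a)

answer : Bool → Fin 6
answer b = if b then yesₐ else noₐ

answer-step : ∀ X b l a r l′ h r′ →
  step M₀ X (config (control (answer b)) (tape l (bit a) r ∷ tape l′ h r′ ∷ []))
    ≡ config (control walk₁) (leftOf l (bit a ∷ r) ∷ tape l′ (bit b) r′ ∷ [])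
answer-step X true  []      a r l′ h r′ = refl
answer-step X true  (_ ∷ _) a r l′ h r′ = refl
answer-step X false []      a r l′ h r′ = refl
answer-step X false (_ ∷ _) a r l′ h r′ = refl

answer-outcome : ∀ X b r q →
  Outcome X 1 (config (control (answer b)) (tape [] blank r ∷ q ∷ [])) b []
answer-outcome X true  r q = outcome refl refl
answer-outcome X false r q = outcome refl refl

last-query-outcome : ∀ X r {w q} → queryWord q ≡ w →
  Outcome X 2 (config query (tape [] blank r ∷ q ∷ [])) (X w) (w ∷ [])
last-query-outcome X r {q = q} refl = before-step refl (answer-outcome X (X (queryWord q)) r q)

-- `acc` collects the letters already passed. Besides one step per letter there are three: off the
-- blank at the left end, the oracle call, and the halting answer state.
rewind-outcome : ∀ X ir ws acc r →
  Outcome X (3 + length ws)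
    (config (control rewind)
      (tape [] blank ir ∷ leftOf (map bit ws ++ blank ∷ []) (map bit acc ++ blank ∷ r) ∷ []))
    (X (ws ʳ++ acc)) ((ws ʳ++ acc) ∷ [])
rewind-outcome X ir []       acc r =
  before-step refl (last-query-outcome X ir (move-right acc [] blank r))
rewind-outcome X ir (w ∷ ws) acc r = before-step
  (cong (λ q → config (control rewind) (tape [] blank ir ∷ q ∷ []))
    (move-left (map bit ws ++ blank ∷ []) (bit w) (map bit acc ++ blank ∷ r)))
  (rewind-outcome X ir ws (w ∷ acc) r)

-- Each round takes four steps (`walk₁`, `walk₂`, the call, the answer) and adds one to the `k`
-- letters to be rewound.
walkTime : ℕ → ℕ → ℕ
walkTime 0             k = 4 + k
walkTime 1             k = 6 + k
walkTime (suc (suc r)) k = 4 + walkTime r (suc k)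

-- `length l ≤ z` keeps the query head on zeros: a round uses up two input letters but only one
-- zero.
walk-outcome : ∀ X l ir z w ws → length l ≤ z →
  Outcome X (walkTime (length l) (length ws))
    (config (control walk₁) (leftOf (map bit l) ir ∷
      tape (map bit ws ++ blank ∷ []) (bit w) (map bit (zeros z)) ∷ []))
    (X (finalWord X (length l) z w ws)) (walkQueries X (length l) z w ws)
walk-outcome X [] ir z w ws _ = before-step
  (cong (λ q → config (control rewind) (tape [] blank ir ∷ q ∷ []))
    (move-left (map bit ws ++ blank ∷ []) blank (map bit (zeros z))))
  (rewind-outcome X ir ws [] _)
walk-outcome X (a ∷ []) ir (suc z) w ws _ =
  before-step refl (before-step refl (rewind-outcome X (bit a ∷ ir) (w ∷ ws) [] _))
walk-outcome X (a ∷ a′ ∷ l) ir (suc z) w ws (s≤s l<z) =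
  before-step refl (before-step refl
    -- The word read off the tape equals `zeros (suc z)` only propositionally, and both the verdict
    -- and the query list depend on it.
    (subst (λ v → Outcome X (2 + walkTime (length l) (suc (length ws))) c
                    (X (finalWord X (length l) z (X v) (w ∷ ws)))
                    (v ∷ walkQueries X (length l) z (X v) (w ∷ ws)))
      (cong (false ∷_) (leadingBits-all (zeros z)))
      (before-step refl (before-step
        (answer-step X (X (queryOf M₀ c)) (map bit l) a′ (bit a ∷ ir) _ _ _)
        (walk-outcome X l (bit a′ ∷ bit a ∷ ir) z (X (queryOf M₀ c)) (w ∷ ws) (<⇒≤ l<z))))))
  where
  c : Config M₀
  c = config query (tape (map bit l) (bit a′) (bit a ∷ ir) ∷
        tape (map bit (w ∷ ws) ++ blank ∷ []) (bit false) (map bit (zeros z)) ∷ [])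

inputFrom : List (Symbol 0) → Word → Tape 0
inputFrom l []      = tape l blank []
inputFrom l (a ∷ x) = tape l (bit a) (map bit x)

move-input : ∀ l a x → move right (tape l (bit a) (map bit x)) ≡ inputFrom (bit a ∷ l) x
move-input l a []      = refl
move-input l a (_ ∷ _) = refl

-- Passing through `noₐ` after copying uses up one letter and records a 0, so the walk starts with
-- `m` letters, `m` zeros and that 0 under the head. On the empty input `noₐ` meets a blank at once
-- and rejects.
verdict₀ : Language → ℕ → Bool
verdict₀ X zero    = false
verdict₀ X (suc m) = X (finalWord X m m false [])

queries₀ : Language → ℕ → List Word
queries₀ X zero    = []
queries₀ X (suc m) = walkQueries X m m false []

time₀ : ℕ → ℕ
time₀ n = 2 + walkTime (pred n) 0

copy-outcome : ∀ X l x {n} → length x + length l ≡ n →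
  Outcome X (length x + time₀ n)
    (config (control copy)
      (inputFrom (map bit l) x ∷ tape [] blank (map bit (zeros (length l))) ∷ []))
    (verdict₀ X n) (queries₀ X n)
copy-outcome X []      []      refl = outcome refl refl
copy-outcome X (a ∷ l) []      refl =
  before-step refl (before-step
    (answer-step X false (map bit l) a (blank ∷ []) _ (bit false) (map bit (zeros (length l))))
    (walk-outcome X l _ (length l) false [] ≤-refl))
copy-outcome X l       (a ∷ x) refl = before-step
  (cong (λ i → config (control copy) (i ∷ tape [] blank (map bit (zeros (suc (length l)))) ∷ []))
    (move-input (map bit l) a x))
  (copy-outcome X (a ∷ l) x (+-suc (length x) (length l)))

initial-input : ∀ x → inputTape x ≡ inputFrom [] x
initial-input []      = refl
initial-input (_ ∷ _) = refl

-- A round costs four steps and one more in the rewind, hence at most 3 per input letter.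
walkTime-bound : ∀ r k → walkTime r k ≤ 6 + (r * 3 + k)
walkTime-bound 0             k = m≤n+m (4 + k) 2
walkTime-bound 1             k = +-monoʳ-≤ 6 (m≤n+m k 3)
walkTime-bound (suc (suc r)) k = begin
  4 + walkTime r (suc k)       ≤⟨ +-monoʳ-≤ 4 (walkTime-bound r (suc k)) ⟩
  10 + (r * 3 + suc k)         ≡⟨ cong (10 +_) (+-suc (r * 3) k) ⟩
  11 + (r * 3 + k)             ≤⟨ n≤1+n _ ⟩
  6 + (suc (suc r) * 3 + k)    ∎
  where open ≤-Reasoning

bound₀ : Polynomial
bound₀ = 8 ∷ 4 ∷ []

time₀-bound : ∀ n → n + time₀ n ≤ eval bound₀ n
time₀-bound n = begin
  n + (2 + walkTime (pred n) 0)  ≤⟨ +-monoʳ-≤ n (+-monoʳ-≤ 2 (walkTime-bound (pred n) 0)) ⟩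
  n + (8 + (pred n * 3 + 0))     ≤⟨ +-monoʳ-≤ n (+-monoʳ-≤ 8 (+-monoˡ-≤ 0 3*pred≤)) ⟩
  n + (8 + (n * 3 + 0))          ≡⟨ rearrange n ⟩
  8 + n * (4 + n * 0)            ∎
  where
  open ≤-Reasoning
  3*pred≤ : pred n * 3 ≤ n * 3
  3*pred≤ = *-monoˡ-≤ 3 (pred[n]≤n {n})
  rearrange : ∀ n → n + (8 + (n * 3 + 0)) ≡ 8 + n * (4 + n * 0)
  rearrange = solve-∀

outcome₀ : ∀ X x → Outcome X (eval bound₀ (length x)) (initial M₀ x)
                     (verdict₀ X (length x)) (queries₀ X (length x))
outcome₀ X x rewrite initial-input x =
  let outcome v a = copy-outcome X [] x (+-identityʳ (length x))
      t≤ = time₀-bound (length x)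
  in outcome (state-extend M₀ X t≤ v) (trans (queries-extend M₀ X t≤ v) a)

-- The invariant survives a round, in which `r` drops by two, `z` drops by one and `ws` grows by
-- one. At the end it bounds the final word by `z`, below the preceding length `suc z`.
walkQueries-decreasing : ∀ X r z w ws → length ws + r ≤ z →
  Linked _>_ (suc z ∷ map length (walkQueries X r z w ws))
walkQueries-decreasing X 0 z w ws ≤z =
  s≤s (subst (_≤ z) (trans (+-identityʳ _) (sym (length-reverse ws))) ≤z) ∷ [-]
walkQueries-decreasing X 1 z w ws ≤z =
  s≤s (subst (_≤ z) (trans (+-comm _ 1) (sym (length-reverse (w ∷ ws)))) ≤z) ∷ [-]
walkQueries-decreasing X (suc (suc r)) z w ws ≤z
  with s≤s {n = y} ≤y ← subst (_≤ z) (trans (+-suc _ _) (cong suc (+-suc _ r))) ≤z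
  = s≤s (≤-reflexive (length-replicate (suc y))) ∷
    subst (λ v → Linked _>_ (v ∷ map length (walkQueries X r y (X (zeros (suc y))) (w ∷ ws))))
      (sym (length-replicate (suc y)))
      (walkQueries-decreasing X r y (X (zeros (suc y))) (w ∷ ws) ≤y)

queries₀-decreasing : ∀ X n → Linked _>_ (n ∷ map length (queries₀ X n))
queries₀-decreasing X zero    = [-]
queries₀-decreasing X (suc m) = walkQueries-decreasing X m m false [] ≤-refl

-- `β` is indexed from the shortest query upwards while the walk asks the longest first; hence `i`
-- counts down, and the answers still to come stand in front of `w ∷ ws`. The odd number
-- `suc (i * 2)` of letters leads to the final case that keeps the last answer.
finalWord-answers : ∀ X j (β : ℕ → Bool) → (∀ i → i < j → X (zeros (2 + (i + j))) ≡ β i) →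
  ∀ i w ws → i ≤ j →
  finalWord X (suc (i * 2)) (suc (i + j)) w ws ≡ reverse (applyUpTo β i ++ w ∷ ws)
finalWord-answers X j β X≡β zero    w ws i≤j = refl
finalWord-answers X j β X≡β (suc i) w ws i<j
  rewrite X≡β i i<j = trans
    (finalWord-answers X j β X≡β i (β i) (w ∷ ws) (<⇒≤ i<j))
    (cong reverse (trans (sym (++-assoc (applyUpTo β i) (β i ∷ []) (w ∷ ws)))
      (cong (_++ w ∷ ws) (applyUpTo-∷ʳ β i))))

double : ∀ j → j + j ≡ j * 2
double = solve-∀

verdict₀-answers : ∀ X j (β : ℕ → Bool) → (∀ i → i < j → X (zeros (2 + (i + j))) ≡ β i) →
  verdict₀ X (2 + j * 2) ≡ X (false ∷ reverse (applyUpTo β j))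
verdict₀-answers X j β X≡β = cong X (begin
  finalWord X m (suc (j * 2)) false []   ≡⟨ cong (λ z → finalWord X m (suc z) false []) (double j) ⟨
  finalWord X m (suc (j + j)) false []   ≡⟨ finalWord-answers X j β X≡β j false [] ≤-refl ⟩
  reverse (applyUpTo β j ++ false ∷ [])  ≡⟨ reverse-++ (applyUpTo β j) (false ∷ []) ⟩
  false ∷ reverse (applyUpTo β j)        ∎)
  where
  open ≡-Reasoning
  m : ℕ
  m = suc (j * 2)

-- Counting

n<2^n : ∀ n → n < 2 ^ n
n<2^n zero    = s≤s z≤n
n<2^n (suc n) = begin
  2 + n         ≤⟨ s≤s (n<2^n n) ⟩
  1 + 2 ^ n     ≤⟨ +-monoˡ-≤ (2 ^ n) (m^n>0 2 n) ⟩
  2 ^ n + 2 ^ n ≡⟨ cong (2 ^ n +_) (+-identityʳ (2 ^ n)) ⟨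
  2 ^ suc n     ∎
  where open ≤-Reasoning

-- Controls degree and coefficients by one number, so that one stage can serve all polynomials up to
-- a given weight.
weight : Polynomial → ℕ
weight []      = 0
weight (c ∷ p) = suc (c + weight p)

-- Horner step with `y ≥ 1`: `c + y ≤ suc c * y ≤ 2 ^ c * y`. The positive exponent `suc m` gives
-- `c ≤ suc m * c`.
eval≤2^ : ∀ p {n} m → n ≤ 2 ^ suc m → eval p n ≤ 2 ^ (suc m * weight p)
eval≤2^ []      m n≤ = z≤n
eval≤2^ (c ∷ p) {n} m n≤ = begin
  c + n * eval p n                        ≤⟨ +-monoʳ-≤ c (*-mono-≤ n≤ (eval≤2^ p m n≤)) ⟩
  c + 2 ^ suc m * 2 ^ (suc m * weight p)  ≡⟨ cong (c +_) (^-distribˡ-+-* 2 (suc m) _) ⟨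
  c + y                                   ≤⟨ +-monoˡ-≤ y (m≤m*n c y) ⟩
  c * y + y                               ≡⟨ +-comm (c * y) y ⟩
  suc c * y                               ≤⟨ *-monoˡ-≤ y (n<2^n c) ⟩
  2 ^ c * y                               ≤⟨ *-monoˡ-≤ y (^-monoʳ-≤ 2 (m≤m+n c (m * c))) ⟩
  2 ^ (suc m * c) * y                     ≡⟨ ^-distribˡ-+-* 2 (suc m * c) _ ⟨
  2 ^ (suc m * c + e)                     ≡⟨ cong (2 ^_) (collect m c (weight p)) ⟩
  2 ^ (suc m * weight (c ∷ p))            ∎
  where
  open ≤-Reasoning
  e y : ℕ
  e = suc m + suc m * weight p
  y = 2 ^ e
  instance _ = m^n≢0 2 e
  collect : ∀ m c w → suc m * c + (suc m + suc m * w) ≡ suc m * suc (c + w)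
  collect = solve-∀

-- Compares exponents for a stage: it yields `T < 2 ^ j`, so the run is too short to ask all
-- candidate words.
quadratic<2^ : ∀ κ → (4 + 2 * κ) * κ < 2 ^ (2 + 2 * κ)
quadratic<2^ κ = begin-strict
  (4 + 2 * κ) * κ         <⟨ *-monoʳ-< (4 + 2 * κ) (n<2^n κ) ⟩
  (4 + 2 * κ) * 2 ^ κ     ≡⟨ cong (_* 2 ^ κ) (factor κ) ⟨
  2 * (2 + κ) * 2 ^ κ     ≤⟨ *-monoˡ-≤ (2 ^ κ) (*-monoʳ-≤ 2 (n<2^n (suc κ))) ⟩
  2 ^ (2 + κ) * 2 ^ κ     ≡⟨ ^-distribˡ-+-* 2 (2 + κ) κ ⟨
  2 ^ (2 + κ + κ)         ≡⟨ cong (2 ^_) (total κ) ⟩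
  2 ^ (2 + 2 * κ)         ∎
  where
  open ≤-Reasoning
  factor : ∀ κ → 2 * (2 + κ) ≡ 4 + 2 * κ
  factor = solve-∀
  total : ∀ κ → 2 + κ + κ ≡ 2 + 2 * κ
  total = solve-∀

branch : Bool → List Word → List Word
branch b []            = []
branch b ([]      ∷ L) = branch b L
branch b ((a ∷ w) ∷ L) with b Bool.≟ a
... | yes _ = w ∷ branch b L
... | no  _ = branch b L

∈-branch : ∀ b {w} L → b ∷ w ∈ L → w ∈ branch b L
∈-branch b ([]      ∷ L) (there i) = ∈-branch b L i
∈-branch b ((a ∷ w) ∷ L) i with b Bool.≟ a
∈-branch b ((a ∷ w) ∷ L) (here refl) | yes _  = here refl
∈-branch b ((a ∷ w) ∷ L) (there i)   | yes _  = there (∈-branch b L i)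
∈-branch b ((a ∷ w) ∷ L) (here refl) | no b≢a = contradiction refl b≢a
∈-branch b ((a ∷ w) ∷ L) (there i)   | no _   = ∈-branch b L i

length-branches : ∀ L → length (branch true L) + length (branch false L) ≤ length L
length-branches []                = z≤n
length-branches ([] ∷ L)          = m≤n⇒m≤1+n (length-branches L)
length-branches ((true ∷ w) ∷ L)  = s≤s (length-branches L)
length-branches ((false ∷ w) ∷ L) =
  subst (_≤ suc (length L)) (sym (+-suc _ _)) (s≤s (length-branches L))

smaller-half : ∀ a b {c} → a + b < c + c → a < c ⊎ b < c
smaller-half a b {c} lt with a <? c | b <? c
... | yes a<c | _       = inj₁ a<c
... | no _    | yes b<c = inj₂ b<c
... | no a≮c  | no b≮c  = contradiction (+-mono-≤ (≮⇒≥ a≮c) (≮⇒≥ b≮c)) (<⇒≱ lt)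

unlisted-∷ : ∀ b j L → ∃[ f ] applyUpTo f j ∉ branch b L → ∃[ f ] applyUpTo f (suc j) ∉ L
unlisted-∷ b j L (f , f∉) = (λ { zero → b ; (suc i) → f i }) , f∉ ∘ ∈-branch b L

-- Splitting by the first letter, one of the two branches lists fewer than half as many words, and
-- the search descends into it. The result is a function because oracle answers are indexed by
-- numbers.
unlisted-word : ∀ j (L : List Word) → length L < 2 ^ j → ∃[ f ] applyUpTo f j ∉ L
unlisted-word zero    []      lt = (λ _ → false) , λ ()
unlisted-word zero    (_ ∷ _) (s≤s ())
unlisted-word (suc j) L       lt
  with smaller-half (length (branch true L)) (length (branch false L)) {2 ^ j}
         (≤-<-trans (length-branches L)
           (subst (length L <_) (cong (2 ^ j +_) (+-identityʳ (2 ^ j))) lt))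
... | inj₁ lt′ = unlisted-∷ true  j L (unlisted-word j (branch true L) lt′)
... | inj₂ lt′ = unlisted-∷ false j L (unlisted-word j (branch false L) lt′)

-- Enumeration of the oracle machines

diagonal-next : ℕ × ℕ → ℕ × ℕ
diagonal-next (zero  , y) = suc y , zero
diagonal-next (suc x , y) = x , suc y

unpair : ℕ → ℕ × ℕ
unpair zero    = zero , zero
unpair (suc n) = diagonal-next (unpair n)

unpair-reaches : ∀ d x y → x + y ≡ d → ∃[ n ] unpair n ≡ (x , y)
unpair-reaches d       x       (suc y) eq
  with n , eq′ ← unpair-reaches d (suc x) y (trans (sym (+-suc x y)) eq) =
  suc n , cong diagonal-next eq′
unpair-reaches zero    zero    zero    eq = zero , refl
unpair-reaches (suc d) (suc x) zero    eq
  with n , eq′ ← unpair-reaches d zero d refl =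
  suc n , trans (cong diagonal-next eq′)
    (cong (_, zero) (trans (sym eq) (cong suc (+-identityʳ x))))

unpair-surjective : StrictlySurjective _≡_ unpair
unpair-surjective (x , y) = unpair-reaches (x + y) x y refl

record Enumeration (A : Set) (_≈_ : A → A → Set) : Set where
  field
    decode     : ℕ → A
    surjective : StrictlySurjective _≈_ decode

open Enumeration

-- `f-onto` gives arguments reaching `c` and says that `f` respects the relations there; the
-- relations carry no laws of their own.
pairs : ∀ {A B C _≈A_ _≈B_ _≈_} → Enumeration A _≈A_ → Enumeration B _≈B_ →
        (f : A → B → C) →
        (∀ c → ∃[ a ] ∃[ b ] ∀ {a′ b′} → a′ ≈A a → b′ ≈B b → f a′ b′ ≈ c) →
        Enumeration C _≈_
pairs EA EB f f-onto .decode n = f (decode EA (proj₁ (unpair n))) (decode EB (proj₂ (unpair n)))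
pairs {_≈_ = _≈_} EA EB f f-onto .surjective c
  with a , b , f≈ ← f-onto c
  with m , m≈ ← surjective EA a
  with n , n≈ ← surjective EB b
  with k , eq ← unpair-surjective (m , n)
  = k , subst (λ { (m , n) → f (decode EA m) (decode EB n) ≈ c }) (sym eq) (f≈ m≈ n≈)

image : ∀ {A B _≈A_ _≈_} → Enumeration A _≈A_ → (f : A → B) →
        (∀ b → ∃[ a ] ∀ {a′} → a′ ≈A a → f a′ ≈ b) → Enumeration B _≈_
image EA f f-onto .decode n = f (decode EA n)
image EA f f-onto .surjective b
  with a , f≈ ← f-onto b
  with n , n≈ ← surjective EA a = n , f≈ n≈

cap : ∀ n → ℕ → Fin (suc n)
cap n       zero    = zero
cap zero    (suc _) = zero
cap (suc n) (suc i) = suc (cap n i)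

cap-toℕ : ∀ n i → cap n (toℕ i) ≡ i
cap-toℕ n       zero    = refl
cap-toℕ (suc n) (suc i) = cong suc (cap-toℕ n i)

fins : ∀ n → Enumeration (Fin (suc n)) _≡_
fins n .decode       = cap n
fins n .surjective i = toℕ i , cap-toℕ n i

vectors : ∀ {A} → Enumeration A _≡_ → ∀ n → Enumeration (Vec A n) _≡_
vectors EA zero    .decode _      = []
vectors EA zero    .surjective [] = 0 , refl
vectors EA (suc n) = pairs EA (vectors EA n) _∷_ λ { (a ∷ v) → a , v , cong₂ _∷_ }

Pointwise : ∀ {A B : Set} → (B → B → Set) → (A → B) → (A → B) → Set
Pointwise _≈_ f g = ∀ a → f a ≈ g a

finFunctions : ∀ {A _≈_} → Enumeration A _≈_ → ∀ n → Enumeration (Fin n → A) (Pointwise _≈_)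
finFunctions EA zero    .decode _ = λ ()
finFunctions EA zero    .surjective _ = 0 , λ ()
finFunctions EA (suc n) = pairs EA (finFunctions EA n)
  (λ { a f zero → a ; a f (suc i) → f i })
  (λ f → f zero , f ∘ suc , λ { a≈ f≈ zero → a≈ ; a≈ f≈ (suc i) → f≈ i })

record Finite (A : Set) : Set where
  field
    size-1   : ℕ
    index    : A → Fin (suc size-1)
    element  : Fin (suc size-1) → A
    inverse  : ∀ a → element (index a) ≡ a

open Finite

elements : ∀ {A} → Finite A → Enumeration A _≡_
elements F = image (fins (size-1 F)) (element F) λ a → index F a , λ { refl → inverse F a }

functions : ∀ {A B _≈_} → Finite A → Enumeration B _≈_ → Enumeration (A → B) (Pointwise _≈_)
functions {_≈_ = _≈_} F EB = image (finFunctions EB (suc (size-1 F))) (_∘ index F)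
  λ f → f ∘ element F , λ g≈ a → subst (λ a′ → _ ≈ f a′) (inverse F a) (g≈ (index F a))

vectorFunctions : ∀ {A B} → Finite A → Enumeration B _≡_ → ∀ n →
                  Enumeration (Vec A n → B) (Pointwise _≡_)
vectorFunctions F EB zero    = image EB (λ b _ → b) λ f → f [] , λ { b≡ [] → b≡ }
vectorFunctions F EB (suc n) = image
  (functions F (vectorFunctions F EB n)) (λ { f (a ∷ v) → f a v })
  λ f → (λ a v → f (a ∷ v)) , λ { f≈ (a ∷ v) → f≈ a v }

symbols : ∀ g → Finite (Symbol g)
symbols g .size-1 = 2 + g
symbols g .index blank       = zero
symbols g .index (bit false) = suc zero
symbols g .index (bit true)  = suc (suc zero)
symbols g .index (aux i)     = suc (suc (suc i))
symbols g .element zero                = blank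
symbols g .element (suc zero)          = bit false
symbols g .element (suc (suc zero))    = bit true
symbols g .element (suc (suc (suc i))) = aux i
symbols g .inverse blank       = refl
symbols g .inverse (bit false) = refl
symbols g .inverse (bit true)  = refl
symbols g .inverse (aux i)     = refl

states : ∀ s → Finite (State s)
states s .size-1 = 2 + s
states s .index query        = zero
states s .index (halt false) = suc zero
states s .index (halt true)  = suc (suc zero)
states s .index (control i)  = suc (suc (suc i))
states s .element zero                = query
states s .element (suc zero)          = halt false
states s .element (suc (suc zero))    = halt true
states s .element (suc (suc (suc i))) = control i
states s .inverse query        = refl
states s .inverse (halt false) = refl
states s .inverse (halt true)  = refl
states s .inverse (control i)  = refl

moves : Finite Move
moves .size-1 = 2
moves .index left  = zero
moves .index stay  = suc zero
moves .index right = suc (suc zero)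
moves .element zero             = left
moves .element (suc zero)       = stay
moves .element (suc (suc zero)) = right
moves .inverse left  = refl
moves .inverse stay  = refl
moves .inverse right = refl

products : ∀ {A B} → Enumeration A _≡_ → Enumeration B _≡_ → Enumeration (A × B) _≡_
products EA EB = pairs EA EB _,_ λ { (a , b) → a , b , cong₂ _,_ }

Transition : ℕ → ℕ → ℕ → Set
Transition g s k = Fin s → Vec (Symbol g) (2 + k) → State s × Vec (Symbol g × Move) (2 + k)

transitions : ∀ g s k → Enumeration (Transition g s k) (Pointwise (Pointwise _≡_))
transitions g s k = finFunctions
  (vectorFunctions (symbols g)
    (products (elements (states s))
      (vectors (products (elements (symbols g)) (elements moves)) (2 + k)))
    (2 + k))
  s

-- Without function extensionality the enumeration reaches a machine only up to
-- pointwise equality of its transition function.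
data _≋_ : OracleTM → OracleTM → Set where
  same-transitions : ∀ {g s k a y n} {δ δ′ : Transition g s k} → Pointwise (Pointwise _≡_) δ δ′ →
    record { g = g ; s = s ; k = k ; start = a ; yes = y ; no = n ; δ = δ } ≋
    record { g = g ; s = s ; k = k ; start = a ; yes = y ; no = n ; δ = δ′ }

-- The number of states is stored decreased by one: `start` rules out a machine with none.
Program : ℕ × ℕ × ℕ → Set
Program (g , s , k) = (Fin (suc s) × Fin (suc s) × Fin (suc s)) × Transition g (suc s) k

_≈ᵖ_ : ∀ {i} → Program i → Program i → Set
(a , δ) ≈ᵖ (a′ , δ′) = a ≡ a′ × Pointwise (Pointwise _≡_) δ δ′

programs : ∀ i → Enumeration (Program i) _≈ᵖ_
programs (g , s , k) = pairs
  (products (fins s) (products (fins s) (fins s))) (transitions g (suc s) k) _,_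
  λ { (a , δ) → a , δ , _,_ }

assemble : ∀ i → Program i → OracleTM
assemble (g , s , k) ((a , y , n) , δ) =
  record { g = g ; s = suc s ; k = k ; start = a ; yes = y ; no = n ; δ = δ }

naturals : Enumeration ℕ _≡_
naturals .decode n     = n
naturals .surjective n = n , refl

-- A number codes an index and a position in the enumeration of its fibre; indices are matched by
-- equality because the fibre depends on them.
families : ∀ {I C _≈_} {B : I → Set} {_≈B_ : ∀ {i} → B i → B i → Set} →
  Enumeration I _≡_ → (∀ i → Enumeration (B i) _≈B_) → (f : ∀ i → B i → C) →
  (∀ c → ∃[ i ] ∃[ b ] ∀ {b′} → b′ ≈B b → f i b′ ≈ c) → Enumeration C _≈_
families {_≈_ = _≈_} {_≈B_ = _≈B_} EI EB f f-onto = pairs EI naturals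
  (λ i n → f i (decode (EB i) n))
  λ c → let i , b , f≈ = f-onto c
            n , n≈ = surjective (EB i) b
        in i , n , λ { refl refl → f≈ n≈ }

opaque
  machines : Enumeration OracleTM _≋_
  machines = families (products naturals (products naturals naturals)) programs assemble onto
    where
    onto : ∀ M → ∃[ i ] ∃[ p ] ∀ {p′} → p′ ≈ᵖ p → assemble i p′ ≋ M
    onto record { g = g ; s = suc s ; k = k ; start = a ; yes = y ; no = n ; δ = δ } =
      (g , s , k) , ((a , y , n) , δ) , λ { (refl , δ≈) → same-transitions δ≈ }

module _ {g s k : ℕ} {a y n : Fin s} {δ δ′ : Transition g s k}
  (δ≈δ′ : Pointwise (Pointwise _≡_) δ δ′) where

  private
    M M′ : OracleTM
    M  = record { g = g ; s = s ; k = k ; start = a ; yes = y ; no = n ; δ = δ }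
    M′ = record { g = g ; s = s ; k = k ; start = a ; yes = y ; no = n ; δ = δ′ }

  -- The two configuration types are distinct although their fields agree.
  convert : Config M → Config M′
  convert (config q ts) = config q ts

  step-convert : ∀ X c → step M′ X (convert c) ≡ convert (step M X c)
  step-convert X (config (control q) ts) rewrite δ≈δ′ q (Vec.map head ts) = refl
  step-convert X (config query       ts) = refl
  step-convert X (config (halt _)    ts) = refl

  run-convert : ∀ X t c → run M′ X t (convert c) ≡ convert (run M X t c)
  run-convert X zero    c = refl
  run-convert X (suc t) c =
    trans (cong (run M′ X t) (step-convert X c)) (run-convert X t (step M X c))

  askedAt-convert : ∀ c qs → askedAt M′ (convert c) qs ≡ askedAt M c qs
  askedAt-convert (config (control _) _) qs = refl
  askedAt-convert (config query       _) qs = refl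
  askedAt-convert (config (halt _)    _) qs = refl

  queries-convert : ∀ X t c → queriesFrom M′ X t (convert c) ≡ queriesFrom M X t c
  queries-convert X zero    c = refl
  queries-convert X (suc t) c = trans (askedAt-convert c _) (cong (askedAt M c)
    (trans (cong (queriesFrom M′ X t) (step-convert X c)) (queries-convert X t (step M X c))))

≋-queries : ∀ {M M′} → M ≋ M′ → ∀ X t x →
            queriesFrom M X t (initial M x) ≡ queriesFrom M′ X t (initial M′ x)
≋-queries (same-transitions δ≈) X t x = sym (queries-convert δ≈ X t _)

≋-verdict : ∀ {M M′} → M ≋ M′ → ∀ X t x {b} → state (run M′ X t (initial M′ x)) ≡ halt b →
            state (run M X t (initial M x)) ≡ halt b
≋-verdict (same-transitions δ≈) X t x h = trans (sym (cong state (run-convert δ≈ X t _))) h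

-- The diagonalisation

-- Words of length at least `2 + j` are answered by length alone, which sets all the zero queries at
-- once; `2 + j` is the length of the shortest of them.
patch : ℕ → (ℕ → Bool) → Word → Bool → Language → Language
patch j β u b X w =
  if does (suc j <? length w) then β (length w ∸ (2 + j)) else
  if does (≡-dec Bool._≟_ w u) then b else X w

patch-answers : ∀ j β u b X i → patch j β u b X (zeros (2 + (i + j))) ≡ β i
patch-answers j β u b X i
  rewrite length-replicate (i + j) {false}
        | dec-true (suc j <? 2 + (i + j)) (s≤s (s≤s (m≤n+m j i))) = cong β (m+n∸n≡m i j)

patch-target : ∀ j β u b X → length u ≡ suc j → patch j β u b X u ≡ b
patch-target j β u b X |u|
  rewrite dec-false (suc j <? length u) (≤⇒≯ (≤-reflexive |u|))
        | dec-true (≡-dec Bool._≟_ u u) refl = refl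

patch-other : ∀ j β u b X w → length w ≤ suc j → w ≢ u → patch j β u b X w ≡ X w
patch-other j β u b X w w≤ w≢u
  rewrite dec-false (suc j <? length w) (≤⇒≯ w≤)
        | dec-false (≡-dec Bool._≟_ w u) w≢u = refl

patch-bit : ∀ j β u b b′ X w → w ≢ u → patch j β u b X w ≡ patch j β u b′ X w
patch-bit j β u b b′ X w w≢u rewrite dec-false (≡-dec Bool._≟_ w u) w≢u = refl

length≤sum : ∀ {q : Word} qs → q ∈ qs → length q ≤ sum (map length qs)
length≤sum (q ∷ qs) (here refl) = m≤m+n (length q) _
length≤sum (p ∷ qs) (there q∈)  = ≤-trans (length≤sum qs q∈) (m≤n+m _ (length p))

-- One stage of the construction of `A`

module Stage (M : OracleTM) (K N : ℕ) (X : Language) where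

  -- `κ` dominates both `K` and `N`: hence `N ≤ j`, and since `n ≤ 2 ^ (4 + 2 * κ)`, every
  -- polynomial of weight at most `K` is at most `T` at `n`. The size of `j` makes `T < 2 ^ j`.
  κ j n T : ℕ
  κ = K + N
  j = 2 ^ (2 + 2 * κ)
  n = 2 + j * 2
  T = 2 ^ ((4 + 2 * κ) * κ)

  c₀ : Config M
  c₀ = initial M (zeros n)

  blind : List Word
  blind = queriesFrom M X T c₀

  -- The map undoes the formation of `target` from `β`, so an unlisted `β` keeps `target` out of
  -- `blind`. There is no circularity: `blind` is computed with `X`, before `β` is chosen.
  unlisted : ∃[ β ] applyUpTo β j ∉ map (reverse ∘ drop 1) blind
  unlisted = unlisted-word j (map (reverse ∘ drop 1) blind) (begin-strict
    length (map (reverse ∘ drop 1) blind) ≡⟨ length-map (reverse ∘ drop 1) blind ⟩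
    length blind                          ≤⟨ length-queries M X T c₀ ⟩
    T                                     <⟨ ^-monoʳ-< 2 (s≤s (s≤s z≤n)) (quadratic<2^ κ) ⟩
    2 ^ j                                 ∎)
    where open ≤-Reasoning

  β : ℕ → Bool
  β = proj₁ unlisted

  target : Word
  target = false ∷ reverse (applyUpTo β j)

  length-target : length target ≡ suc j
  length-target = cong suc (trans (length-reverse (applyUpTo β j)) (length-applyUpTo β j))

  target∉blind : target ∉ blind
  target∉blind t∈ = proj₂ unlisted (subst (_∈ map (reverse ∘ drop 1) blind)
    (reverse-involutive (applyUpTo β j)) (∈-map⁺ (reverse ∘ drop 1) t∈))

  patched : Bool → Language
  patched b = patch j β target b X

  -- `X′` is defined from this value, so it is taken with the provisional bit `false`; a run that
  -- never asks `target` cannot see that bit.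
  prediction : Bool
  prediction = accepting (state (run M (patched false) T c₀))

  X′ : Language
  X′ = patched (not prediction)

  -- Freezes every word that matters for the stage: those asked by `M₀`, all shorter than `n`, and
  -- those asked by `M`, bounded by the sum of their lengths.
  N′ : ℕ
  N′ = suc N + (n + sum (map length (queriesFrom M X′ T c₀)))

  N≤j : N ≤ j
  N≤j = begin
    N           ≤⟨ m≤n+m N K ⟩
    κ           ≤⟨ m≤m+n κ _ ⟩
    2 * κ       ≤⟨ m≤n+m (2 * κ) 2 ⟩
    2 + 2 * κ   ≤⟨ <⇒≤ (n<2^n (2 + 2 * κ)) ⟩
    j           ∎
    where open ≤-Reasoning

  unchanged : ∀ w → length w ≤ N → X′ w ≡ X w
  unchanged w w≤N = patch-other j β target _ X w (m≤n⇒m≤1+n w≤j)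
    λ { refl → <-irrefl refl (subst (_≤ j) length-target w≤j) }
    where
    w≤j : length w ≤ j
    w≤j = ≤-trans w≤N N≤j

  N<N′ : N < N′
  N<N′ = m≤m+n (suc N) _

  n≤N′ : n ≤ N′
  n≤N′ = ≤-trans (m≤m+n n _) (m≤n+m _ (suc N))

  query≤N′ : ∀ {q} → q ∈ queriesFrom M X′ T c₀ → length q ≤ N′
  query≤N′ q∈ = ≤-trans (length≤sum _ q∈) (≤-trans (m≤n+m _ n) (m≤n+m _ (suc N)))

  eval≤T : ∀ p → weight p ≤ K → eval p n ≤ T
  eval≤T p p≤K = begin
    eval p n                       ≤⟨ eval≤2^ p (3 + 2 * κ) n≤ ⟩
    2 ^ ((4 + 2 * κ) * weight p)   ≤⟨ ^-monoʳ-≤ 2 (*-monoʳ-≤ (4 + 2 * κ) p≤κ) ⟩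
    T                              ∎
    where
    open ≤-Reasoning
    p≤κ : weight p ≤ κ
    p≤κ = ≤-trans p≤K (m≤m+n K N)
    n≤ : n ≤ 2 ^ (4 + 2 * κ)
    n≤ = begin
      2 + j * 2       ≤⟨ +-monoˡ-≤ (j * 2) (*-monoˡ-≤ 2 (m^n>0 2 (2 + 2 * κ))) ⟩
      j * 2 + j * 2   ≡⟨ quadruple j ⟩
      2 * (2 * j)     ∎
      where
      quadruple : ∀ j → j * 2 + j * 2 ≡ 2 * (2 * j)
      quadruple = solve-∀

  -- Two changes of oracle: from `X` to `X′` the nondecreasing queries keep `target` unasked, and
  -- then `X′` and `patched false` can differ only at `target`.
  verdict≡prediction : Linked _≤_ (map length (queriesFrom M X′ T c₀)) →
    ∀ {b} → state (run M X′ T c₀) ≡ halt b → b ≡ prediction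
  verdict≡prediction lnd h = sym (accepting-halt (trans (cong state (sym (proj₁ same))) h))
    where
    target∉queries : target ∉ queriesFrom M X′ T c₀
    target∉queries = nondecreasing-avoids M {X} {X′} target
      (λ w w≤ w≢ → sym (patch-other j β target _ X w (subst (length w ≤_) length-target w≤) w≢))
      T c₀ lnd target∉blind
    same : run M X′ T c₀ ≡ run M (patched false) T c₀ × _
    same = run-agree M {X′} {patched false} T c₀
      λ q q∈ → patch-bit j β target _ _ X q λ { refl → target∉queries q∈ }

  module _ {Y : Language} (Y≡X′ : ∀ w → length w ≤ N′ → Y w ≡ X′ w) where

    verdict₀-at-zeros : verdict₀ Y (length (zeros n)) ≡ not prediction
    verdict₀-at-zeros = begin
      verdict₀ Y (length (zeros n))  ≡⟨ cong (verdict₀ Y) (length-replicate n) ⟩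
      verdict₀ Y n                   ≡⟨ verdict₀-answers Y j β answers ⟩
      Y target                       ≡⟨ Y≡X′ target target≤ ⟩
      X′ target                      ≡⟨ patch-target j β target _ X length-target ⟩
      not prediction                 ∎
      where
      open ≡-Reasoning
      j+j≤n : 2 + (j + j) ≤ n
      j+j≤n = ≤-reflexive (cong (2 +_) (double j))
      target≤ : length target ≤ N′
      target≤ = ≤-trans (≤-reflexive length-target)
        (≤-trans (s≤s (m≤n⇒m≤1+n (m≤m+n j j))) (≤-trans j+j≤n n≤N′))
      answers : ∀ m → m < j → Y (zeros (2 + (m + j))) ≡ β m
      answers m m<j = trans
        (Y≡X′ _ (≤-trans (≤-reflexive (length-replicate (2 + (m + j))))
          (≤-trans (s≤s (s≤s (+-monoˡ-≤ j (<⇒≤ m<j)))) (≤-trans j+j≤n n≤N′))))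
        (patch-answers j β target _ X m)

    -- The run of `D` with `Y` is prolonged to `T`, carried over to the pointwise equal machine `M`,
    -- and then to `X′`, since all queries have length at most `N′`. There the prediction applies,
    -- and `M₀` contradicts it.
    not-reduced : ∀ D → M ≋ machine D → weight (DPTM.bound D) ≤ K →
      (∀ x → Linked _≤_ (map length (queries D Y x))) →
      ¬ ((verdict₀ Y ∘ length) ≐L[ D ^ Y ])
    not-reduced D M≋ weight≤K lnd solves =
      not-¬ b≡prediction (trans b≡verdict verdict₀-at-zeros)
      where
      p : Polynomial
      p = DPTM.bound D
      b : Bool
      b = proj₁ (DPTM.halts D Y (zeros n))
      haltsD : state (run (machine D) Y (eval p (length (zeros n)))
                       (initial (machine D) (zeros n))) ≡ halt b
      haltsD = proj₂ (DPTM.halts D Y (zeros n))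
      t≤T : eval p (length (zeros n)) ≤ T
      t≤T = subst (λ l → eval p l ≤ T) (sym (length-replicate n)) (eval≤T p weight≤K)
      halted : state (run (machine D) Y T (initial (machine D) (zeros n))) ≡ halt b
      halted = state-extend (machine D) Y t≤T haltsD
      same : run M X′ T c₀ ≡ run M Y T c₀ × queriesFrom M X′ T c₀ ≡ queriesFrom M Y T c₀
      same = run-agree M {X′} {Y} T c₀ λ q q∈ → sym (Y≡X′ q (query≤N′ q∈))
      same-queries : queriesFrom M X′ T c₀ ≡ queries D Y (zeros n)
      same-queries = trans (proj₂ same) (trans (≋-queries M≋ Y T (zeros n))
        (queries-extend (machine D) Y t≤T haltsD))
      b≡prediction : b ≡ prediction
      b≡prediction = verdict≡prediction
        (subst (Linked _≤_ ∘ map length) (sym same-queries) (lnd (zeros n)))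
        (trans (cong state (proj₁ same)) (≋-verdict M≋ Y T (zeros n) halted))
      b≡verdict : b ≡ verdict₀ Y (length (zeros n))
      b≡verdict = verdict-decides (machine D) {verdict₀ Y ∘ length} Y solves (zeros n) T halted

-- The limit of the stages

machineAt : ℕ → OracleTM
machineAt i = decode machines (proj₁ (unpair i))

exponentAt : ℕ → ℕ
exponentAt i = proj₂ (unpair i)

threshold : ℕ → ℕ
oracle    : ℕ → Language
threshold zero    = 0
threshold (suc i) = Stage.N′ (machineAt i) (exponentAt i) (threshold i) (oracle i)
oracle zero    _ = false
oracle (suc i)   = Stage.X′ (machineAt i) (exponentAt i) (threshold i) (oracle i)

module StageAt (i : ℕ) = Stage (machineAt i) (exponentAt i) (threshold i) (oracle i)

-- Stage `length w` is late enough for `w`, since thresholds grow by at least one per stage.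
A : Language
A w = oracle (length w) w

i≤threshold : ∀ i → i ≤ threshold i
i≤threshold zero    = z≤n
i≤threshold (suc i) = ≤-<-trans (i≤threshold i) (StageAt.N<N′ i)

threshold-mono : ∀ d i → threshold i ≤ threshold (d + i)
threshold-mono zero    i = ≤-refl
threshold-mono (suc d) i = ≤-trans (threshold-mono d i) (<⇒≤ (StageAt.N<N′ (d + i)))

oracle-stable : ∀ d i w → length w ≤ threshold i → oracle (d + i) w ≡ oracle i w
oracle-stable zero    i w w≤ = refl
oracle-stable (suc d) i w w≤ =
  trans (StageAt.unchanged (d + i) w (≤-trans w≤ (threshold-mono d i))) (oracle-stable d i w w≤)

-- Both stages are compared with stage `i + length w`, which is no earlier than either.
A≡oracle : ∀ i w → length w ≤ threshold i → A w ≡ oracle i w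
A≡oracle i w w≤ = begin
  oracle (length w) w       ≡⟨ oracle-stable i (length w) w (i≤threshold (length w)) ⟨
  oracle (i + length w) w   ≡⟨ cong (λ m → oracle m w) (+-comm i (length w)) ⟩
  oracle (length w + i) w   ≡⟨ oracle-stable (length w) i w w≤ ⟩
  oracle i w                ∎
  where open ≡-Reasoning

B : Language
B = verdict₀ A ∘ length

D₀ : DPTM
D₀ = record
  { machine = M₀
  ; bound   = bound₀
  ; halts   = λ X x → verdict₀ X (length x) , Outcome.verdict (outcome₀ X x)
  }

B≤A : B ≤ᵖ-sld-T A
B≤A = D₀ ,
  (λ x → accepts⇔ M₀ A x (eval bound₀ (length x)) (Outcome.verdict (outcome₀ A x))) ,
  (λ x → subst (λ qs → Linked _>_ (length x ∷ map length qs)) (sym (Outcome.asked (outcome₀ A x)))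
    (queries₀-decreasing A (length x)))

B≰A : ¬ (B ≤ᵖ-lnd-T A)
B≰A (D , B≐ , lnd) =
  let e , e≈ = surjective machines (machine D)
      -- The stage that treats the machine of `D` with `K` equal to the weight of its time bound.
      i , i≡ = unpair-surjective (e , weight (DPTM.bound D))
  in StageAt.not-reduced i (A≡oracle (suc i)) D
       (subst (λ p → decode machines (proj₁ p) ≋ machine D) (sym i≡) e≈)
       (≤-reflexive (cong proj₂ (sym i≡))) lnd B≐

theorem4p9 : Σ[ A ∈ Language ] Σ[ B ∈ Language ] (B ≤ᵖ-sld-T A × ¬ (B ≤ᵖ-lnd-T A))
theorem4p9 = A , B , B≤A , B≰A
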